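{- Suppose $k\ge 3$ and $n\ge 2$. If $S$ is an $\mathcal{NAS}_k(n)$ of period $m$ then $$ m\le \begin{cases} \dfrac{k^n-1}{2} & \text{if } k \text{ is odd},\\[2mm] \dfrac{k^n-2^n}{2} & \text{if } k \text{ is even}. \end{cases}$$
   Context: For a sequence $S=(s_i)_{i\ge0}$ with entries in $\mathbb{Z}_k$ write $\mathbf{s}_n(i)=(s_i,\dots,s_{i+n-1})$; an $n$-tuple occurs in $S$ if it equals $\mathbf{s}_n(i)$ for some $i$. A $k$-ary $n$-window sequence is a periodic sequence over $\mathbb{Z}_k$, of period $m$ say, such that $\mathbf{s}_n(i)=\mathbf{s}_n(j)$ implies $i\equiv j\pmod m$. For $k\ge3$, $n\ge2$, an $\mathcal{NAS}_k(n)$ ($k$-ary Negative Avoiding Sequence of span $n$) is a $k$-ary $n$-window sequence $S$ such that whenever an $n$-tuple $\mathbf{a}=(a_0,\dots,a_{n-1})$ occurs in $S$, its negative $-\mathbf{a}=(-a_0,\dots,-a_{n-1})$ does not occur in $S$. -}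

module Defs where

open import Data.Fin using (Fin; toℕ)
open import Data.Nat using (ℕ; suc; _+_; _∸_; _<_; ∣_-_∣)
open import Data.Nat.Divisibility using (_∣_)
open import Data.Nat.DivMod using (_mod_)
open import Data.Product using (∃-syntax)
open import Data.Vec using (Vec; map; tabulate)
open import Relation.Binary.PropositionalEquality using (_≡_)
open import Relation.Nullary using (¬_)

-- ℤ/kℤ, each class given by its representative in {0, …, k - 1}.
ℤ/ : ℕ → Set
ℤ/ k = Fin k

-- Additive inverse modulo k; the final reduction sends k ∸ 0 back to 0.
-- There is no case for k = 0 because Fin 0 is empty.
neg : ∀ {k} → ℤ/ k → ℤ/ k
neg {suc k} a = (suc k ∸ toℕ a) mod suc k

Sequence : ℕ → Set
Sequence k = ℕ → ℤ/ k

Tuple : ℕ → ℕ → Set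
Tuple k n = Vec (ℤ/ k) n

negTuple : ∀ {k n} → Tuple k n → Tuple k n
negTuple = map neg

window : ∀ {k} → Sequence k → (n i : ℕ) → Tuple k n
window s n i = tabulate (λ l → s (i + toℕ l))

_OccursIn_ : ∀ {k n} → Tuple k n → Sequence k → Set
_OccursIn_ {n = n} a s = ∃[ i ] a ≡ window s n i

_≡_[mod_] : ℕ → ℕ → ℕ → Set
i ≡ j [mod m ] = m ∣ ∣ i - j ∣

record HasPeriod {k : ℕ} (s : Sequence k) (m : ℕ) : Set where
  field
    positive : 0 < m
    periodic : ∀ i → s (i + m) ≡ s i

-- Minimality of m is not required separately: if p is a period then
-- window s n 0 ≡ window s n p, so windowInjective forces m to divide p.
record IsWindowSequence (k n m : ℕ) (s : Sequence k) : Set where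
  field
    hasPeriod       : HasPeriod s m
    windowInjective : ∀ i j → window s n i ≡ window s n j → i ≡ j [mod m ]

-- S is an NAS_k(n) of period m.
record IsNAS (k n m : ℕ) (s : Sequence k) : Set where
  field
    isWindowSequence : IsWindowSequence k n m s
    negativeAvoiding : ∀ (a : Tuple k n) → a OccursIn s → ¬ (negTuple a OccursIn s)

{-# OPTIONS --safe #-}
-- The windows of one period, their negatives, and the self-negative n-tuples
-- are pairwise distinct, so 2m + f ≤ kⁿ where f is the number of self-negative
-- tuples. Such a tuple has all its entries in {0} for odd k and in {0, k/2} for
-- even k, so f is 1ⁿ or 2ⁿ; only f ≥ 1ⁿ and f ≥ 2ⁿ are needed.
module Submission where

open import Defs
open import Data.Empty using (⊥-elim)
open import Data.Fin using (Fin; zero; suc; toℕ; fromℕ<; combine; funToFin; finToFun)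
open import Data.Fin.Properties
  using (toℕ<n; toℕ-fromℕ<; toℕ-injective; injective⇒≤; +↔⊎; finToFun-funToFin; funToFin-finToFin)
open import Data.Nat using (ℕ; zero; suc; _+_; _*_; _∸_; _^_; _≤_; _<_; _≥_; ∣_-_∣; z≤n; s≤s)
open import Data.Nat.Divisibility using (_∣_; divides; >⇒∤)
open import Data.Nat.DivMod using (_/_; _%_; _mod_; m*n/n≡m; /-monoˡ-≤; n%n≡0; m<n⇒m%n≡m)
open import Data.Nat.Properties
  using ( +-suc; +-assoc; +-identityʳ; *-comm; ^-zeroˡ; 1+n≢0; <⇒≤; ≤-<-trans; ⊔-pres-<m; m<m+n
        ; m∸n≤m; m+n∸m≡n; m∸n+n≡m; m+n≤o⇒m≤o∸n; ∣m-n∣≡0⇒m≡n; ∣m-n∣≤m⊔n; module ≤-Reasoning )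
open import Data.Product using (_×_; _,_)
open import Data.Sum using (_⊎_; inj₁; inj₂; [_,_]′)
open import Data.Sum.Function.Propositional using (_⊎-↣_)
open import Data.Vec using (lookup; map; tabulate)
open import Data.Vec.Properties
  using (lookup∘tabulate; tabulate∘lookup; tabulate-cong; tabulate-∘; map-id; map-∘; map-cong)
open import Function using (_∘_; _↣_; Injection; mk↣; Injective)
open import Function.Construct.Composition using (_↣-∘_)
open import Function.Construct.Identity using (↣-id)
open import Function.Properties.Inverse using (↔⇒↣)
open import Relation.Binary.PropositionalEquality
  using (_≡_; _≢_; _≗_; refl; sym; trans; cong; cong₂; subst; module ≡-Reasoning)
open import Relation.Nullary using (¬_)

mod≡ : ∀ a {n} {b : Fin (suc n)} → a % suc n ≡ toℕ b → a mod suc n ≡ b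
mod≡ _ eq = toℕ-injective (trans (toℕ-fromℕ< _) eq)

neg-zero : ∀ {k} → neg {suc k} zero ≡ zero
neg-zero {k} = mod≡ (suc k) (n%n≡0 (suc k))

-- The sum is taken in ℕ, so `k ∸ toℕ a` is exactly `toℕ b`, which lies below `k` and survives the
-- final reduction. The residue 0, paired with itself, has sum 0 and is treated by `neg-zero`.
neg-unique : ∀ {k} (a b : ℤ/ k) → toℕ a + toℕ b ≡ k → neg a ≡ b
neg-unique {suc k} a b a+b≡k = mod≡ (suc k ∸ toℕ a) (begin
  (suc k ∸ toℕ a) % suc k            ≡⟨ cong (λ x → (x ∸ toℕ a) % suc k) a+b≡k ⟨
  (toℕ a + toℕ b ∸ toℕ a) % suc k    ≡⟨ cong (_% suc k) (m+n∸m≡n (toℕ a) (toℕ b)) ⟩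
  toℕ b % suc k                      ≡⟨ m<n⇒m%n≡m (toℕ<n b) ⟩
  toℕ b                              ∎)
  where open ≡-Reasoning

-- For a nonzero residue the subtraction already lands below the modulus. With the negative as left
-- summand, `neg-unique` yields the negative of the negative.
neg-suc-+ : ∀ {k} (a : Fin k) → toℕ (neg (suc a)) + toℕ (suc a) ≡ suc k
neg-suc-+ {k} a = begin
  toℕ (neg (suc a)) + suc (toℕ a)      ≡⟨ cong (_+ suc (toℕ a)) (toℕ-fromℕ< _) ⟩
  (k ∸ toℕ a) % suc k + suc (toℕ a)    ≡⟨ cong (_+ suc (toℕ a)) (m<n⇒m%n≡m (s≤s (m∸n≤m k (toℕ a)))) ⟩
  (k ∸ toℕ a) + suc (toℕ a)            ≡⟨ +-suc (k ∸ toℕ a) (toℕ a) ⟩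
  suc ((k ∸ toℕ a) + toℕ a)            ≡⟨ cong suc (m∸n+n≡m (<⇒≤ (toℕ<n a))) ⟩
  suc k                                ∎
  where open ≡-Reasoning

neg-involutive : ∀ {k} (a : ℤ/ k) → neg (neg a) ≡ a
neg-involutive zero    = trans (cong neg neg-zero) neg-zero
neg-involutive (suc a) = neg-unique (neg (suc a)) (suc a) (neg-suc-+ a)

negTuple-involutive : ∀ {k n} (a : Tuple k n) → negTuple (negTuple a) ≡ a
negTuple-involutive a = begin
  map neg (map neg a)    ≡⟨ map-∘ neg neg a ⟨
  map (neg ∘ neg) a      ≡⟨ map-cong neg-involutive a ⟩
  map (λ x → x) a        ≡⟨ map-id a ⟩
  a                      ∎
  where open ≡-Reasoning

negTuple-injective : ∀ {k n} → Injective _≡_ _≡_ (negTuple {k} {n})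
negTuple-injective {x = a} {b} eq = begin
  a                        ≡⟨ negTuple-involutive a ⟨
  negTuple (negTuple a)    ≡⟨ cong negTuple eq ⟩
  negTuple (negTuple b)    ≡⟨ negTuple-involutive b ⟩
  b                        ∎
  where open ≡-Reasoning

[,]-injective : ∀ {A B C : Set} {f : A → C} {g : B → C} →
  Injective _≡_ _≡_ f → Injective _≡_ _≡_ g → (∀ x y → f x ≢ g y) →
  Injective _≡_ _≡_ [ f , g ]′
[,]-injective f-inj g-inj f≢g {inj₁ x} {inj₁ y} eq = cong inj₁ (f-inj eq)
[,]-injective f-inj g-inj f≢g {inj₁ x} {inj₂ y} eq = ⊥-elim (f≢g x y eq)
[,]-injective f-inj g-inj f≢g {inj₂ x} {inj₁ y} eq = ⊥-elim (f≢g y x (sym eq))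
[,]-injective f-inj g-inj f≢g {inj₂ x} {inj₂ y} eq = cong inj₂ (g-inj eq)

funToFin-cong : ∀ {m n} {f g : Fin m → Fin n} → f ≗ g → funToFin f ≡ funToFin g
funToFin-cong {zero}  f≗g = refl
funToFin-cong {suc m} f≗g = cong₂ combine (f≗g zero) (funToFin-cong (f≗g ∘ suc))

finToFun-injective : ∀ {m n} {i j : Fin (m ^ n)} → finToFun {m} {n} i ≗ finToFun j → i ≡ j
finToFun-injective {m} {n} {i} {j} eq = begin
  i                               ≡⟨ funToFin-finToFin {n} {m} i ⟨
  funToFin (finToFun {m} {n} i)   ≡⟨ funToFin-cong eq ⟩
  funToFin (finToFun {m} {n} j)   ≡⟨ funToFin-finToFin {n} {m} j ⟩
  j                               ∎
  where open ≡-Reasoning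

tabulate-injective : ∀ {A : Set} {n} {f g : Fin n → A} → tabulate f ≡ tabulate g → f ≗ g
tabulate-injective {f = f} {g} eq l = begin
  f l                      ≡⟨ lookup∘tabulate f l ⟨
  lookup (tabulate f) l    ≡⟨ cong (λ v → lookup v l) eq ⟩
  lookup (tabulate g) l    ≡⟨ lookup∘tabulate g l ⟩
  g l                      ∎
  where open ≡-Reasoning

-- A tuple is encoded as a number in base `k`; it is recovered from its digits, which are compared
-- position by position.
tuple↣Fin : ∀ {k n} → Tuple k n ↣ Fin (k ^ n)
tuple↣Fin {k} {n} = mk↣ {to = funToFin ∘ lookup} λ {a} {b} eq → begin
  a                      ≡⟨ tabulate∘lookup a ⟨
  tabulate (lookup a)    ≡⟨ tabulate-cong (λ l → begin
    lookup a l                                  ≡⟨ finToFun-funToFin (lookup a) l ⟨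
    finToFun {k} {n} (funToFin (lookup a)) l    ≡⟨ cong (λ i → finToFun {k} {n} i l) eq ⟩
    finToFun {k} {n} (funToFin (lookup b)) l    ≡⟨ finToFun-funToFin (lookup b) l ⟩
    lookup b l                                  ∎) ⟩
  tabulate (lookup b)    ≡⟨ tabulate∘lookup b ⟩
  b                      ∎
  where open ≡-Reasoning

-- The distance between two numbers below `m` is itself below `m`, and no positive number below `m`
-- is a multiple of `m`.
≡[mod]⇒≡ : ∀ {m i j} → i < m → j < m → i ≡ j [mod m ] → i ≡ j
≡[mod]⇒≡ {m} {i} {j} i<m j<m m∣d with ∣ i - j ∣ in eq
... | zero  = ∣m-n∣≡0⇒m≡n eq
... | suc d = ⊥-elim (>⇒∤ (subst (_< m) eq (≤-<-trans (∣m-n∣≤m⊔n i j) (⊔-pres-<m i<m j<m))) m∣d)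

module _ {k n m : ℕ} {S : Sequence k} (nas : IsNAS k n m S) where
  open IsNAS nas
  open IsWindowSequence isWindowSequence

  windowAt : Fin m → Tuple k n
  windowAt i = window S n (toℕ i)

  windowAt-injective : Injective _≡_ _≡_ windowAt
  windowAt-injective {i} {j} eq =
    toℕ-injective (≡[mod]⇒≡ (toℕ<n i) (toℕ<n j) (windowInjective (toℕ i) (toℕ j) eq))

  window≢negTuple : ∀ i j → window S n i ≢ negTuple (window S n j)
  window≢negTuple i j eq = negativeAvoiding (window S n j) (j , refl) (i , sym eq)

  -- A self-negative window would equal the negative of the window at the same position, which is
  -- the case `j = i` of `window≢negTuple`.
  window≢selfNegative : ∀ i {a} → negTuple a ≡ a → window S n i ≢ a
  window≢selfNegative i a-self refl = window≢negTuple i i (sym a-self)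

  module _ {e : ℕ} {g : Fin e → ℤ/ k}
           (g-injective : Injective _≡_ _≡_ g) (g-self : ∀ x → neg (g x) ≡ g x) where

    -- The base-`e` digits of the index choose the entries among the `e` residues listed by `g`. The
    -- parity of `k` enters the count only through the choice of `e` and `g`.
    selfNegative : Fin (e ^ n) → Tuple k n
    selfNegative x = tabulate (g ∘ finToFun x)

    selfNegative-self : ∀ x → negTuple (selfNegative x) ≡ selfNegative x
    selfNegative-self x = trans (sym (tabulate-∘ neg _)) (tabulate-cong (g-self ∘ finToFun x))

    selfNegative-injective : Injective _≡_ _≡_ selfNegative
    selfNegative-injective eq =
      finToFun-injective {e} {n} (g-injective ∘ tabulate-injective eq)

    tuples : (Fin m ⊎ (Fin m ⊎ Fin (e ^ n))) ↣ Tuple k n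
    tuples = mk↣ {to = [ windowAt , [ negTuple ∘ windowAt , selfNegative ]′ ]′}
      ([,]-injective windowAt-injective
        ([,]-injective (windowAt-injective ∘ negTuple-injective) selfNegative-injective
          -- Negating both sides of `eq` fixes the self-negative tuple and turns the negated window
          -- back into a window.
          λ i x eq → window≢selfNegative (toℕ i) (selfNegative-self x)
            (negTuple-injective (trans eq (sym (selfNegative-self x)))))
        λ { i (inj₁ j) → window≢negTuple (toℕ i) (toℕ j)
          ; i (inj₂ x) → window≢selfNegative (toℕ i) (selfNegative-self x) })

    count : m + (m + e ^ n) ≤ k ^ n
    count = injective⇒≤ (Injection.injective
      -- Read from right to left: an index below `m + (m + e ^ n)` is split twice to find its
      -- family, sent to its tuple, and encoded below `k ^ n`.
      (tuple↣Fin ↣-∘ (tuples ↣-∘ ((↣-id _ ⊎-↣ ↔⇒↣ +↔⊎) ↣-∘ ↔⇒↣ +↔⊎))))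

    period-bound : m ≤ (k ^ n ∸ e ^ n) / 2
    period-bound = begin
      m                        ≡⟨ m*n/n≡m m 2 ⟨
      m * 2 / 2                ≤⟨ /-monoˡ-≤ 2 (m+n≤o⇒m≤o∸n (m * 2) m*2+eⁿ≤kⁿ) ⟩
      (k ^ n ∸ e ^ n) / 2      ∎
      where
      open ≤-Reasoning
      m*2+eⁿ≤kⁿ : m * 2 + e ^ n ≤ k ^ n
      m*2+eⁿ≤kⁿ = begin
        m * 2 + e ^ n          ≡⟨ cong (_+ e ^ n) (*-comm m 2) ⟩
        m + (m + 0) + e ^ n    ≡⟨ cong (λ x → m + x + e ^ n) (+-identityʳ m) ⟩
        m + m + e ^ n          ≡⟨ +-assoc m m (e ^ n) ⟩
        m + (m + e ^ n)        ≤⟨ count ⟩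
        k ^ n                  ∎

zeroOrHalf : ∀ {k} → ℤ/ (suc k) → Fin 2 → ℤ/ (suc k)
zeroOrHalf h zero       = zero
zeroOrHalf h (suc zero) = h

zeroOrHalf-injective : ∀ {k} {h : ℤ/ (suc k)} → h ≢ zero → Injective _≡_ _≡_ (zeroOrHalf h)
zeroOrHalf-injective h≢0 {zero}     {zero}     eq = refl
zeroOrHalf-injective h≢0 {zero}     {suc zero} eq = ⊥-elim (h≢0 (sym eq))
zeroOrHalf-injective h≢0 {suc zero} {zero}     eq = ⊥-elim (h≢0 eq)
zeroOrHalf-injective h≢0 {suc zero} {suc zero} eq = refl

theorem4p1 : (k n m : ℕ) (S : Sequence k) → k ≥ 3 → n ≥ 2 → IsNAS k n m S →
    (¬ (2 ∣ k) → m ≤ (k ^ n ∸ 1) / 2) × (2 ∣ k → m ≤ (k ^ n ∸ 2 ^ n) / 2)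
theorem4p1 k@(suc _) n m S _ _ nas = odd , even
  where
  odd : ¬ (2 ∣ k) → m ≤ (k ^ n ∸ 1) / 2
  -- With `e = 1` and 0 as the listed residue, the family consists of the zero tuple alone, and
  -- `1 ^ n` becomes 1.
  odd _ = subst (λ f → m ≤ (k ^ n ∸ f) / 2) (^-zeroˡ n)
    (period-bound nas {g = λ _ → zero} (λ { {zero} {zero} _ → refl }) (λ _ → neg-zero))

  even : 2 ∣ k → m ≤ (k ^ n ∸ 2 ^ n) / 2
  -- A zero quotient would force `k` to be 0. That `q` is a successor gives both `q < k` and
  -- `half ≢ zero`.
  even (divides q@(suc q-1) k≡q*2) = period-bound nas (zeroOrHalf-injective half≢0) self
    where
    q+q≡k : q + q ≡ k
    q+q≡k = trans (cong (q +_) (sym (+-identityʳ q))) (trans (*-comm 2 q) (sym k≡q*2))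
    q<k : q < k
    q<k = subst (q <_) q+q≡k (m<m+n q (s≤s z≤n))
    half : ℤ/ k
    half = fromℕ< q<k
    half≢0 : half ≢ zero
    half≢0 eq = 1+n≢0 (trans (sym (toℕ-fromℕ< q<k)) (cong toℕ eq))
    self : ∀ x → neg (zeroOrHalf half x) ≡ zeroOrHalf half x
    self zero       = neg-zero
    -- `half` represents `k / 2`, so adding it to itself gives exactly `k`.
    self (suc zero) = neg-unique half half
      (trans (cong₂ _+_ (toℕ-fromℕ< q<k) (toℕ-fromℕ< q<k)) q+q≡k)
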